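{- Let $P$ be a path on $n$ vertices and let $I, J$ be two $k$-path vertex covers of $P$. Then $I$ and $J$ are reconfigurable under $\mathsf{TJ}$ if and only if $|I| = |J|$. Moreover, a shortest $\mathsf{TJ}$-sequence between $I$ and $J$ (when one exists) can be computed in $O(n)$ time.
   Context: Fix an integer $k \geq 2$. A $k$-path is a path on $k$ vertices. A vertex subset $I \subseteq V(G)$ is a $k$-path vertex cover of $G$ if every $k$-path in $G$ contains at least one vertex of $I$. A sequence $\langle I_0, \dots, I_\ell \rangle$ of $k$-path vertex covers of $G$ has length $\ell$; it is a $\mathsf{TJ}$-sequence between $I_0$ and $I_\ell$ if for each $i<\ell$ there are vertices $x_i,y_i$ with $I_i \setminus I_{i+1} = \{x_i\}$ and $I_{i+1}\setminus I_i = \{y_i\}$. $I$ and $J$ are reconfigurable under $\mathsf{TJ}$ if a $\mathsf{TJ}$-sequence between them exists; a shortest one is one of minimum length. -}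

module Defs where

open import Data.Bool using (Bool; true; false; if_then_else_)
open import Data.Fin using (Fin; zero; suc; toℕ; fromℕ; inject₁)
open import Data.Fin.Subset using (Subset; _∈_; ⁅_⁆; _─_)
open import Data.List using (List; length; lookup)
import Data.List.Membership.Propositional as List
open import Data.List.Relation.Unary.Unique.Propositional using (Unique)
open import Data.Nat using (ℕ; zero; suc; pred; _+_; _*_; _≤_; _<ᵇ_; _≡ᵇ_)
open import Data.Nat.Properties using (m≢1+n+m)
open import Data.Product using (∃; ∃-syntax; Σ-syntax; _×_)
open import Data.Sum using (_⊎_; inj₁; inj₂; swap)
import Data.Vec as Vec
open import Function.Bundles using (_↔_; _⇔_; Inverse)
open import Function.Definitions using (Injective)
open import Relation.Binary.PropositionalEquality using (_≡_; sym)
open import Relation.Nullary using (¬_)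

------------------------------------------------------------------------
-- Graphs and paths

record Graph (n : ℕ) : Set₁ where
  infix 4 _~_
  field
    _~_     : Fin n → Fin n → Set
    ~-sym   : ∀ {u v} → u ~ v → v ~ u
    ~-irrefl : ∀ {v} → ¬ (v ~ v)

pathGraph : ∀ n → Graph n
pathGraph n = record
  { _~_      = λ i j → suc (toℕ i) ≡ toℕ j ⊎ suc (toℕ j) ≡ toℕ i
  ; ~-sym    = swap
  ; ~-irrefl = λ { (inj₁ e) → m≢1+n+m _ {0} (sym e)
                 ; (inj₂ e) → m≢1+n+m _ {0} (sym e) }
  }

record _≅_ {m n} (G : Graph m) (H : Graph n) : Set where
  private
    module G = Graph G
    module H = Graph H
  field
    vertices : Fin m ↔ Fin n
    edges    : ∀ u v → (u G.~ v) ⇔ (Inverse.to vertices u H.~ Inverse.to vertices v)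

IsPath : ∀ {n} → Graph n → Set
IsPath {n} G = G ≅ pathGraph n

-- A path on k vertices occurring in G as a (not necessarily induced) subgraph.
record PathIn {n} (k : ℕ) (G : Graph n) : Set where
  private
    module G = Graph G
    module P = Graph (pathGraph k)
  field
    vertex    : Fin k → Fin n
    injective : Injective _≡_ _≡_ vertex
    adjacent  : ∀ {i j} → i P.~ j → vertex i G.~ vertex j

IsPathVertexCover : ∀ {n} → ℕ → Graph n → Subset n → Set
IsPathVertexCover k G I = (p : PathIn k G) → ∃[ i ] PathIn.vertex p i ∈ I

------------------------------------------------------------------------
-- Token jumping

record TJStep {n} (I I′ : Subset n) : Set where
  field
    x y     : Fin n
    removed : I ─ I′ ≡ ⁅ x ⁆
    added   : I′ ─ I ≡ ⁅ y ⁆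

record TJSequence {n} (k : ℕ) (G : Graph n) (I J : Subset n) (ℓ : ℕ) : Set where
  field
    set   : Fin (suc ℓ) → Subset n
    cover : ∀ i → IsPathVertexCover k G (set i)
    first : set zero ≡ I
    last  : set (fromℕ ℓ) ≡ J
    step  : (i : Fin ℓ) → TJStep (set (inject₁ i)) (set (suc i))

Reconfigurable : ∀ {n} → ℕ → Graph n → Subset n → Subset n → Set
Reconfigurable k G I J = ∃[ ℓ ] TJSequence k G I J ℓ

-- ℓ is a lower bound on the lengths of all TJ-sequences between I and J;
-- a TJ-sequence of such a length ℓ is a shortest one.
IsShortestLength : ∀ {n} → ℕ → Graph n → Subset n → Subset n → ℕ → Set
IsShortestLength k G I J ℓ = ∀ {ℓ′} → TJSequence k G I J ℓ′ → ℓ ≤ ℓ′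

------------------------------------------------------------------------
-- A unit-cost random access machine
--
-- Programs are finite texts mentioning finitely many registers and arrays, and
-- loads and stores are indexed by registers.  The only arithmetic is successor
-- and predecessor, so that computed numbers never exceed the input numbers and
-- program literals by more than the elapsed time: unit cost cannot be exploited
-- by packing data into huge numbers, as it could with unrestricted addition or
-- multiplication.

Register Array : Set
Register = ℕ
Array    = ℕ

data Test : Set where
  _≺_ _≐_ : Register → Register → Test

infixr 5 _⨾_

data Program : Set where
  skip       : Program
  const      : Register → ℕ → Program
  copy       : Register → Register → Program
  inc dec    : Register → Program
  load       : Register → Array → Register → Program
  store      : Array → Register → Register → Program
  _⨾_        : Program → Program → Program
  branch     : Test → Program → Program → Program
  while      : Test → Program → Program

record State : Set where
  constructor state
  field
    reg : Register → ℕ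
    arr : Array → ℕ → ℕ

open State public

_[_↦_] : ∀ {A : Set} → (ℕ → A) → ℕ → A → ℕ → A
(f [ i ↦ a ]) j = if i ≡ᵇ j then a else f j

setReg : Register → ℕ → State → State
setReg r m s = state (reg s [ r ↦ m ]) (arr s)

setCell : Array → ℕ → ℕ → State → State
setCell a i m s = state (reg s) (arr s [ a ↦ arr s a [ i ↦ m ] ])

test : Test → State → Bool
test (r ≺ q) s = reg s r <ᵇ reg s q
test (r ≐ q) s = reg s r ≡ᵇ reg s q

infix 4 _,_⇓_,_

-- p , s ⇓ s′ , t : started in state s, program p halts in state s′ after t
-- elementary operations, an evaluation of a test counting as one operation.
data _,_⇓_,_ : Program → State → State → ℕ → Set where
  skip   : ∀ {s} → skip , s ⇓ s , 1
  const  : ∀ {r m s} → const r m , s ⇓ setReg r m s , 1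
  copy   : ∀ {r q s} → copy r q , s ⇓ setReg r (reg s q) s , 1
  inc    : ∀ {r s} → inc r , s ⇓ setReg r (suc (reg s r)) s , 1
  dec    : ∀ {r s} → dec r , s ⇓ setReg r (pred (reg s r)) s , 1
  load   : ∀ {r a q s} → load r a q , s ⇓ setReg r (arr s a (reg s q)) s , 1
  store  : ∀ {a q r s} → store a q r , s ⇓ setCell a (reg s q) (reg s r) s , 1
  seq    : ∀ {p p′ s s′ s″ t t′} →
           p , s ⇓ s′ , t → p′ , s′ ⇓ s″ , t′ → p ⨾ p′ , s ⇓ s″ , t + t′
  branch-true  : ∀ {b p p′ s s′ t} → test b s ≡ true →
                 p , s ⇓ s′ , t → branch b p p′ , s ⇓ s′ , suc t
  branch-false : ∀ {b p p′ s s′ t} → test b s ≡ false →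
                 p′ , s ⇓ s′ , t → branch b p p′ , s ⇓ s′ , suc t
  while-false  : ∀ {b p s} → test b s ≡ false → while b p , s ⇓ s , 1
  while-true   : ∀ {b p s s′ s″ t t′} → test b s ≡ true →
                 p , s ⇓ s′ , t → while b p , s′ ⇓ s″ , t′ →
                 while b p , s ⇓ s″ , suc (t + t′)

infix 4 _∈O_

_∈O_ : (ℕ → ℕ) → (ℕ → ℕ) → Set
f ∈O g = ∃[ c ] ∃[ n₀ ] (∀ n → n₀ ≤ n → f n ≤ c * g n)

------------------------------------------------------------------------
-- Input and output of the reconfiguration algorithm

sizeReg lengthReg : Register
sizeReg   = 0
lengthReg = 1

startArr degreeArr neighbourArr sourceArr targetArr removedArr addedArr : Array
startArr     = 0
degreeArr    = 1
neighbourArr = 2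
sourceArr    = 3
targetArr    = 4
removedArr   = 5
addedArr     = 6

-- The graph is given by adjacency lists, in no particular order, the list of v
-- being stored in neighbourArr from position startArr[v] on; the sets are given
-- by their characteristic vectors.  Everything else in memory is arbitrary.
record Encodes {n} (G : Graph n) (I J : Subset n) (s : State) : Set where
  open Graph G
  field
    size       : reg s sizeReg ≡ n
    adj        : Fin n → List (Fin n)
    adj-unique : ∀ v → Unique (adj v)
    adj-edges  : ∀ v w → (w List.∈ adj v) ⇔ (v ~ w)
    degree     : ∀ v → arr s degreeArr (toℕ v) ≡ length (adj v)
    neighbour  : ∀ v (i : Fin (length (adj v))) →
                 arr s neighbourArr (arr s startArr (toℕ v) + toℕ i)
                   ≡ toℕ (lookup (adj v) i)
    source     : ∀ v → arr s sourceArr (toℕ v) ≡ (if Vec.lookup I v then 1 else 0)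
    target     : ∀ v → arr s targetArr (toℕ v) ≡ (if Vec.lookup J v then 1 else 0)

-- Writing out all the sets of a sequence can take quadratically many symbols, so
-- a sequence is output as its length and its moves x₀ , y₀ , x₁ , y₁ , …, which
-- determine it from its first set.
record Outputs {n k ℓ} {G : Graph n} {I J : Subset n}
               (S : TJSequence k G I J ℓ) (s : State) : Set where
  open TJSequence S
  field
    lengthOut : reg s lengthReg ≡ ℓ
    removed   : ∀ i → arr s removedArr (toℕ i) ≡ toℕ (TJStep.x (step i))
    added     : ∀ i → arr s addedArr (toℕ i) ≡ toℕ (TJStep.y (step i))

ComputesShortestTJ : ∀ {n} → ℕ → Program → (time : ℕ) → Graph n → Subset n → Subset n → Set
ComputesShortestTJ k p time G I J =
  ∀ s → Encodes G I J s →
  ∃[ s′ ] ∃[ t ] (p , s ⇓ s′ , t) × t ≤ time ×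
  (∃[ ℓ ] Σ[ S ∈ TJSequence k G I J ℓ ] IsShortestLength k G I J ℓ × Outputs S s′)

{-# OPTIONS --safe #-}

-- Let a₀ < a₁ < … and b₀ < b₁ < … be the positions along the path of the vertices
-- of I ─ J and of J ─ I, of which there are equally many when ∣ I ∣ ≡ ∣ J ∣.  If
-- a₀ < b₀, then I - a₀ + b₀ is again a cover: a k-path avoiding it meets I only in
-- a₀ and meets J at or beyond b₀, hence contains b₀.  If b₀ < a₀, then J - b₀ + a₀
-- is a cover for the same reason, and the move a₀ → b₀ can be made last.  By
-- induction the moves aᵤ → bᵤ, the rightward ones in increasing order of u followed
-- by the leftward ones in decreasing order, form a TJ-sequence.  Its length ∣ I ─ J ∣
-- is the least possible, as a step decreases this number by at most one.
--
-- In linear time: find an end of the path, follow the path to list the vertices in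
-- order, scan that list for the aᵤ and bᵤ, and write the moves from both ends of
-- the output inwards.
module Submission where

open import Defs
open import Data.Bool using (Bool; true; false; if_then_else_; T)
open import Data.Empty using () renaming (⊥ to Empty)
open import Data.Fin using (Fin; zero; suc; toℕ; fromℕ; fromℕ<; inject₁; opposite)
import Data.Fin.Properties as Fin
open import Data.Fin.Subset using (Subset; ∣_∣; _∈_; _∉_; _⊆_; ⁅_⁆; _─_; _-_; _∪_; inside; outside)
open import Data.Fin.Subset.Properties
  using (_∈?_; ⊆-antisym; Empty-unique; ∣⊥∣≡0; ∣⁅x⁆∣≡1; p─⊥≡p; p─q⊆p; ∣p∣≤n;
         x∈p∧x∉q⇒x∈p─q; x∈p∧x≢y⇒x∈p-y; x∈p∪q⁺; x∈p∪q⁻; x∈⁅x⁆; x∈⁅y⁆⇒x≡y)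
open import Data.List using (List; []; _∷_; length)
import Data.List as List
import Data.List.Membership.Propositional as List
open import Data.List.Relation.Unary.All using (_∷_)
open import Data.List.Relation.Unary.AllPairs using (_∷_)
open import Data.List.Relation.Unary.Any using (here; there)
open import Data.List.Relation.Unary.Unique.Propositional using (Unique)
open import Data.Nat
  using (ℕ; zero; suc; pred; _+_; _*_; _∸_; _≤_; _<_; z≤n; s≤s; z<s; s≤s⁻¹; _≡ᵇ_; _<ᵇ_; _<?_)
open import Data.Nat.Properties
open import Data.Product using (Σ-syntax; ∃-syntax; _×_; _,_; proj₁; proj₂)
open import Data.Sum using (_⊎_; inj₁; inj₂; [_,_]′)
open import Data.Unit using (tt) renaming (⊤ to Unit)
open import Data.Vec using ([]; _∷_; here; there; lookup)
open import Data.Vec.Properties using ([]=⇒lookup; lookup⇒[]=)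
open import Function.Base using (id; _∘_)
open import Function.Bundles using (_⇔_; mk⇔; mk↔ₛ′; Inverse; Equivalence)
open import Relation.Binary.Definitions using (tri<; tri≈; tri>)
open import Relation.Binary.PropositionalEquality
open import Relation.Nullary using (¬_; yes; no; contradiction)

private variable
  m n k ℓ : ℕ

-- Subsets and token jumps

x∈p─q⇒x∉q : ∀ {x} (p q : Subset n) → x ∈ p ─ q → x ∉ q
x∈p─q⇒x∉q (_ ∷ _) (outside ∷ _) here ()
x∈p─q⇒x∉q (_ ∷ p) (outside ∷ q) (there x∈) (there x∈q) = x∈p─q⇒x∉q p q x∈ x∈q
x∈p─q⇒x∉q (_ ∷ p) (inside ∷ q) (there x∈) (there x∈q) = x∈p─q⇒x∉q p q x∈ x∈q

p─q-empty⇒p⊆q : ∀ (p q : Subset n) → (∀ {x} → x ∉ p ─ q) → p ⊆ q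
p─q-empty⇒p⊆q p q p─q-empty {x} x∈p with x ∈? q
... | yes x∈q = x∈q
... | no x∉q = contradiction (x∈p∧x∉q⇒x∈p─q x∈p x∉q) p─q-empty

∣p∣≡1+∣p-x∣ : ∀ {x} {p : Subset n} → x ∈ p → ∣ p ∣ ≡ suc ∣ p - x ∣
∣p∣≡1+∣p-x∣ {p = inside ∷ p} here = cong suc (cong ∣_∣ (sym (p─⊥≡p p)))
∣p∣≡1+∣p-x∣ {p = inside ∷ p} (there x∈p) = cong suc (∣p∣≡1+∣p-x∣ x∈p)
∣p∣≡1+∣p-x∣ {p = outside ∷ p} (there x∈p) = ∣p∣≡1+∣p-x∣ x∈p

-- Both sides count `p ∪ q`; the additive form avoids truncated subtraction.
∣p∣+∣q─p∣≡∣q∣+∣p─q∣ : ∀ (p q : Subset n) → ∣ p ∣ + ∣ q ─ p ∣ ≡ ∣ q ∣ + ∣ p ─ q ∣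
∣p∣+∣q─p∣≡∣q∣+∣p─q∣ [] [] = refl
∣p∣+∣q─p∣≡∣q∣+∣p─q∣ (inside ∷ p) (inside ∷ q) = cong suc (∣p∣+∣q─p∣≡∣q∣+∣p─q∣ p q)
∣p∣+∣q─p∣≡∣q∣+∣p─q∣ (inside ∷ p) (outside ∷ q) =
  trans (cong suc (∣p∣+∣q─p∣≡∣q∣+∣p─q∣ p q)) (sym (+-suc _ _))
∣p∣+∣q─p∣≡∣q∣+∣p─q∣ (outside ∷ p) (inside ∷ q) =
  trans (+-suc _ _) (cong suc (∣p∣+∣q─p∣≡∣q∣+∣p─q∣ p q))
∣p∣+∣q─p∣≡∣q∣+∣p─q∣ (outside ∷ p) (outside ∷ q) = ∣p∣+∣q─p∣≡∣q∣+∣p─q∣ p q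

-- An element of `p` outside `r` lies either outside `q` or in `q ─ r`. This triangle inequality
-- limits what a single step can achieve.
∣p─r∣≤∣p─q∣+∣q─r∣ : ∀ (p q r : Subset n) → ∣ p ─ r ∣ ≤ ∣ p ─ q ∣ + ∣ q ─ r ∣
∣p─r∣≤∣p─q∣+∣q─r∣ [] [] [] = z≤n
∣p─r∣≤∣p─q∣+∣q─r∣ (inside ∷ p) (inside ∷ q) (inside ∷ r) = ∣p─r∣≤∣p─q∣+∣q─r∣ p q r
∣p─r∣≤∣p─q∣+∣q─r∣ (inside ∷ p) (inside ∷ q) (outside ∷ r) =
  ≤-trans (s≤s (∣p─r∣≤∣p─q∣+∣q─r∣ p q r)) (≤-reflexive (sym (+-suc _ _)))
∣p─r∣≤∣p─q∣+∣q─r∣ (inside ∷ p) (outside ∷ q) (inside ∷ r) = m≤n⇒m≤1+n (∣p─r∣≤∣p─q∣+∣q─r∣ p q r)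
∣p─r∣≤∣p─q∣+∣q─r∣ (inside ∷ p) (outside ∷ q) (outside ∷ r) = s≤s (∣p─r∣≤∣p─q∣+∣q─r∣ p q r)
∣p─r∣≤∣p─q∣+∣q─r∣ (outside ∷ p) (inside ∷ q) (inside ∷ r) = ∣p─r∣≤∣p─q∣+∣q─r∣ p q r
∣p─r∣≤∣p─q∣+∣q─r∣ (outside ∷ p) (inside ∷ q) (outside ∷ r) =
  ≤-trans (m≤n⇒m≤1+n (∣p─r∣≤∣p─q∣+∣q─r∣ p q r)) (≤-reflexive (sym (+-suc _ _)))
∣p─r∣≤∣p─q∣+∣q─r∣ (outside ∷ p) (outside ∷ q) (inside ∷ r) = ∣p─r∣≤∣p─q∣+∣q─r∣ p q r
∣p─r∣≤∣p─q∣+∣q─r∣ (outside ∷ p) (outside ∷ q) (outside ∷ r) = ∣p─r∣≤∣p─q∣+∣q─r∣ p q r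

jump : Subset n → Fin n → Fin n → Subset n
jump I a b = (I - a) ∪ ⁅ b ⁆

x∈p-y⇒x≢y : ∀ {x y} (p : Subset n) → x ∈ p - y → x ≢ y
x∈p-y⇒x≢y {x = x} p x∈ refl = x∈p─q⇒x∉q p ⁅ x ⁆ x∈ (x∈⁅x⁆ x)

∈jump⁻ : ∀ {I : Subset n} {a b x} → x ∈ jump I a b → (x ∈ I × x ≢ a) ⊎ x ≡ b
∈jump⁻ {I = I} {a} {b} x∈ with x∈p∪q⁻ (I - a) ⁅ b ⁆ x∈
... | inj₁ x∈I-a = inj₁ (p─q⊆p I ⁅ a ⁆ x∈I-a , x∈p-y⇒x≢y I x∈I-a)
... | inj₂ x∈b = inj₂ (x∈⁅y⁆⇒x≡y b x∈b)

∈jump⁺ˡ : ∀ {I : Subset n} {a b x} → x ∈ I → x ≢ a → x ∈ jump I a b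
∈jump⁺ˡ x∈I x≢a = x∈p∪q⁺ (inj₁ (x∈p∧x≢y⇒x∈p-y x∈I x≢a))

∈jump⁺ʳ : ∀ {I : Subset n} {a b} → b ∈ jump I a b
∈jump⁺ʳ {b = b} = x∈p∪q⁺ (inj₂ (x∈⁅x⁆ b))

─jump : ∀ (I : Subset n) {a b} → a ∈ I → b ∉ I → I ─ jump I a b ≡ ⁅ a ⁆
─jump I {a} {b} a∈I b∉I = ⊆-antisym to from
  where
  to : I ─ jump I a b ⊆ ⁅ a ⁆
  to {x} x∈ with x Fin.≟ a
  ... | yes refl = x∈⁅x⁆ a
  ... | no x≢a = contradiction (∈jump⁺ˡ (p─q⊆p I _ x∈) x≢a) (x∈p─q⇒x∉q I _ x∈)
  from : ⁅ a ⁆ ⊆ I ─ jump I a b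
  from x∈ with refl ← x∈⁅y⁆⇒x≡y a x∈ = x∈p∧x∉q⇒x∈p─q a∈I λ a∈jump →
    [ (λ a∈ → proj₂ a∈ refl) , (λ { refl → b∉I a∈I }) ]′ (∈jump⁻ a∈jump)

jump─ : ∀ (I : Subset n) {a b} → b ∉ I → jump I a b ─ I ≡ ⁅ b ⁆
jump─ I {a} {b} b∉I = ⊆-antisym to from
  where
  to : jump I a b ─ I ⊆ ⁅ b ⁆
  to x∈ with ∈jump⁻ (p─q⊆p _ I x∈)
  ... | inj₁ (x∈I , _) = contradiction x∈I (x∈p─q⇒x∉q _ I x∈)
  ... | inj₂ refl = x∈⁅x⁆ b
  from : ⁅ b ⁆ ⊆ jump I a b ─ I
  from x∈ with refl ← x∈⁅y⁆⇒x≡y b x∈ = x∈p∧x∉q⇒x∈p─q (∈jump⁺ʳ {I = I}) b∉I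

-- The arriving vertex lies in `J`, so it cannot enter the difference. Together with `─-jump`, this
-- lets one jump consume one entry of each enumeration.
jump-─ : ∀ (I J : Subset n) {a b} → b ∈ J → jump I a b ─ J ≡ (I ─ J) - a
jump-─ I J {a} {b} b∈J = ⊆-antisym to from
  where
  to : jump I a b ─ J ⊆ (I ─ J) - a
  to x∈ with ∈jump⁻ (p─q⊆p _ J x∈)
  ... | inj₁ (x∈I , x≢a) = x∈p∧x≢y⇒x∈p-y (x∈p∧x∉q⇒x∈p─q x∈I (x∈p─q⇒x∉q _ J x∈)) x≢a
  ... | inj₂ refl = contradiction b∈J (x∈p─q⇒x∉q _ J x∈)
  from : (I ─ J) - a ⊆ jump I a b ─ J
  from x∈ = x∈p∧x∉q⇒x∈p─q (∈jump⁺ˡ (p─q⊆p I J x∈I─J) (x∈p-y⇒x≢y (I ─ J) x∈)) (x∈p─q⇒x∉q I J x∈I─J)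
    where x∈I─J = p─q⊆p (I ─ J) ⁅ a ⁆ x∈

─-jump : ∀ (I J : Subset n) {a b} → a ∉ J → J ─ jump I a b ≡ (J ─ I) - b
─-jump I J {a} {b} a∉J = ⊆-antisym to from
  where
  to : J ─ jump I a b ⊆ (J ─ I) - b
  to {x} x∈ = x∈p∧x≢y⇒x∈p-y
    (x∈p∧x∉q⇒x∈p─q x∈J (λ x∈I → x∉jump (∈jump⁺ˡ x∈I λ { refl → a∉J x∈J })))
    (λ { refl → x∉jump (∈jump⁺ʳ {I = I}) })
    where
    x∈J = p─q⊆p J _ x∈
    x∉jump = x∈p─q⇒x∉q J _ x∈
  from : (J ─ I) - b ⊆ J ─ jump I a b
  from {x} x∈ = x∈p∧x∉q⇒x∈p─q (p─q⊆p J I x∈J─I) x∉jump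
    where
    x∈J─I = p─q⊆p (J ─ I) ⁅ b ⁆ x∈
    x∉jump : x ∉ jump I a b
    x∉jump x∈jump with ∈jump⁻ x∈jump
    ... | inj₁ (x∈I , _) = x∈p─q⇒x∉q J I x∈J─I x∈I
    ... | inj₂ x≡b = x∈p-y⇒x≢y (J ─ I) x∈ x≡b

jumpStep : ∀ {I : Subset n} {a b} → a ∈ I → b ∉ I → TJStep I (jump I a b)
jumpStep {I = I} {a} {b} a∈I b∉I = record
  { x = a ; y = b ; removed = ─jump I a∈I b∉I ; added = jump─ I b∉I }

reverseStep : ∀ {I J : Subset n} → TJStep I J → TJStep J I
reverseStep s = record { x = y ; y = x ; removed = added ; added = removed }
  where open TJStep s

step-card : ∀ {I J : Subset n} → TJStep I J → ∣ I ∣ ≡ ∣ J ∣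
step-card {I = I} {J} s = +-cancelʳ-≡ 1 _ _ (begin
  ∣ I ∣ + 1          ≡⟨ cong (∣ I ∣ +_) (∣⁅x⁆∣≡1 y) ⟨
  ∣ I ∣ + ∣ ⁅ y ⁆ ∣  ≡⟨ cong (λ p → ∣ I ∣ + ∣ p ∣) added ⟨
  ∣ I ∣ + ∣ J ─ I ∣  ≡⟨ ∣p∣+∣q─p∣≡∣q∣+∣p─q∣ I J ⟩
  ∣ J ∣ + ∣ I ─ J ∣  ≡⟨ cong (λ p → ∣ J ∣ + ∣ p ∣) removed ⟩
  ∣ J ∣ + ∣ ⁅ x ⁆ ∣  ≡⟨ cong (∣ J ∣ +_) (∣⁅x⁆∣≡1 x) ⟩
  ∣ J ∣ + 1          ∎)
  where open TJStep s; open ≡-Reasoning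

steps-card : ∀ ℓ (set : Fin (suc ℓ) → Subset n) →
             (∀ i → TJStep (set (inject₁ i)) (set (suc i))) → ∣ set zero ∣ ≡ ∣ set (fromℕ ℓ) ∣
steps-card zero set step = refl
steps-card (suc ℓ) set step = trans (step-card (step zero)) (steps-card ℓ (set ∘ suc) (step ∘ suc))

-- The set removed by a step is a singleton, so by the triangle inequality the difference from `J`
-- shrinks by at most one per step.
steps-─ : ∀ ℓ (set : Fin (suc ℓ) → Subset n) (J : Subset n) →
          (∀ i → TJStep (set (inject₁ i)) (set (suc i))) →
          ∣ set zero ─ J ∣ ≤ ℓ + ∣ set (fromℕ ℓ) ─ J ∣
steps-─ zero set J step = ≤-refl
steps-─ (suc ℓ) set J step = begin
  ∣ set zero ─ J ∣                                   ≤⟨ ∣p─r∣≤∣p─q∣+∣q─r∣ (set zero) (set (suc zero)) J ⟩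
  ∣ set zero ─ set (suc zero) ∣ + ∣ set (suc zero) ─ J ∣
    ≡⟨ cong (_+ ∣ set (suc zero) ─ J ∣) (trans (cong ∣_∣ removed) (∣⁅x⁆∣≡1 x)) ⟩
  suc ∣ set (suc zero) ─ J ∣                         ≤⟨ s≤s (steps-─ ℓ (set ∘ suc) J (step ∘ suc)) ⟩
  suc (ℓ + ∣ set (fromℕ (suc ℓ)) ─ J ∣)              ∎
  where open TJStep (step zero); open ≤-Reasoning

∣p─p∣≡0 : ∀ (p : Subset n) → ∣ p ─ p ∣ ≡ 0
∣p─p∣≡0 [] = refl
∣p─p∣≡0 (inside ∷ p) = ∣p─p∣≡0 p
∣p─p∣≡0 (outside ∷ p) = ∣p─p∣≡0 p

reconfigurable⇒card : ∀ {G : Graph n} {I J} → Reconfigurable k G I J → ∣ I ∣ ≡ ∣ J ∣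
reconfigurable⇒card (ℓ , record { set = set ; first = refl ; last = refl ; step = step }) =
  steps-card ℓ set step

─-shortest : ∀ {G : Graph n} {I J} → IsShortestLength k G I J ∣ I ─ J ∣
─-shortest {J = J} {ℓ′ = ℓ} record { set = set ; first = refl ; last = refl ; step = step } =
  ≤-trans (steps-─ ℓ set J step)
    (≤-reflexive (trans (cong (ℓ +_) (∣p─p∣≡0 J)) (+-identityʳ ℓ)))

-- Covers of a path

position : {G : Graph m} {H : Graph n} → G ≅ H → Fin m → ℕ
position φ v = toℕ (Inverse.to (_≅_.vertices φ) v)

position-injective : {G : Graph m} {H : Graph n} (φ : G ≅ H) →
                     ∀ {u v} → position φ u ≡ position φ v → u ≡ v
position-injective φ {u} {v} e =
  trans (sym (strictlyInverseʳ u)) (trans (cong from (Fin.toℕ-injective e)) (strictlyInverseʳ v))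
  where open Inverse (_≅_.vertices φ)

intermediate : ∀ {k} (h : Fin k → ℕ) (c : ℕ) →
               (∀ {i j} → suc (toℕ i) ≡ toℕ j → h j ≤ suc (h i) × h i ≤ suc (h j)) →
               ∀ i j → h i ≤ c → c ≤ h j → ∃[ l ] h l ≡ c
intermediate h c step zero zero i≤c c≤j = zero , ≤-antisym i≤c c≤j
intermediate {suc (suc _)} h c step zero (suc j) i≤c c≤j with m≤n⇒m<n∨m≡n i≤c
... | inj₂ eq = zero , eq
... | inj₁ i<c with intermediate (h ∘ suc) c (step ∘ cong suc) zero j
                      (≤-trans (proj₁ (step {zero} {suc zero} refl)) i<c) c≤j
...   | l , eq = suc l , eq
intermediate {suc (suc _)} h c step (suc i) zero i≤c c≤j with m≤n⇒m<n∨m≡n c≤j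
... | inj₂ eq = zero , sym eq
... | inj₁ c<j with intermediate (h ∘ suc) c (step ∘ cong suc) i zero
                      i≤c (s≤s⁻¹ (≤-trans c<j (proj₂ (step {zero} {suc zero} refl))))
...   | l , eq = suc l , eq
intermediate h c step (suc i) (suc j) i≤c c≤j
  with l , eq ← intermediate (h ∘ suc) c (step ∘ cong suc) i j i≤c c≤j = suc l , eq

module _ {G : Graph n} (φ : G ≅ pathGraph n) where
  private
    pos = position φ

  jump-cover : ∀ {I J a b} → IsPathVertexCover k G I → IsPathVertexCover k G J → a ∉ J →
               pos a < pos b → (∀ {v} → v ∈ J ─ I → pos b ≤ pos v) →
               IsPathVertexCover k G (jump I a b)
  jump-cover {k = k} {I = I} {J} {a} {b} coverI coverJ a∉J a<b b-least p
    with coverJ p | coverI p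
  ... | j , j∈J | i , i∈I with PathIn.vertex p j ∈? I
  ...   | yes j∈I = j , ∈jump⁺ˡ j∈I λ { refl → a∉J j∈J }
  ...   | no j∉I with PathIn.vertex p i Fin.≟ a
  ...     | no i≢a = i , ∈jump⁺ˡ i∈I i≢a
  ...     | yes i≡a = l , subst (_∈ jump I a b) (sym (position-injective φ l≡b)) (∈jump⁺ʳ {I = I})
    where
    open PathIn p
    near : ∀ {i j : Fin k} → suc (toℕ i) ≡ toℕ j →
           pos (vertex j) ≤ suc (pos (vertex i)) × pos (vertex i) ≤ suc (pos (vertex j))
    near {i} {j} e with Equivalence.to (_≅_.edges φ (vertex i) (vertex j)) (adjacent (inj₁ e))
    ... | inj₁ e′ = ≤-reflexive (sym e′) , ≤-trans (n≤1+n _) (m≤n⇒m≤1+n (≤-reflexive e′))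
    ... | inj₂ e′ = ≤-trans (n≤1+n _) (m≤n⇒m≤1+n (≤-reflexive e′)) , ≤-reflexive (sym e′)
    -- In the remaining case `i` sits at `a`, to the left of `b`, and `j` lies in `J ─ I`, at or
    -- beyond `b`, so the path passes through the position of `b`.
    crossing = intermediate (pos ∘ vertex) (pos b) near i j
      (subst (λ v → pos v ≤ pos b) (sym i≡a) (<⇒≤ a<b)) (b-least (x∈p∧x∉q⇒x∈p─q j∈J j∉I))
    l = proj₁ crossing
    l≡b = proj₂ crossing

-- The values of E on [t, d) are, in increasing order, the positions of the
-- vertices satisfying X.
record Enumerates (pos : Fin n → ℕ) (X : Fin n → Set) (E : ℕ → ℕ) (t d : ℕ) : Set where
  field
    sound    : ∀ {u} → t ≤ u → u < d → ∃[ v ] pos v ≡ E u × X v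
    complete : ∀ {v} → X v → ∃[ u ] t ≤ u × u < d × E u ≡ pos v
    mono     : ∀ {u u′} → t ≤ u → u < u′ → u′ < d → E u < E u′

open Enumerates

-- Increasing enumerations of positions

module _ {pos : Fin n → ℕ} {E : ℕ → ℕ} where

  Enumerates-resp : ∀ {X Y : Fin n → Set} {t d} → (∀ {v} → X v → Y v) → (∀ {v} → Y v → X v) →
                    Enumerates pos X E t d → Enumerates pos Y E t d
  Enumerates-resp X⇒Y Y⇒X e = record
    { sound = λ t≤u u<d → let v , eq , x = sound e t≤u u<d in v , eq , X⇒Y x
    ; complete = complete e ∘ Y⇒X
    ; mono = mono e }

  Enumerates-least : ∀ {X : Fin n → Set} {t d v} → Enumerates pos X E t d → pos v ≡ E t →
                     ∀ {w} → X w → pos v ≤ pos w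
  Enumerates-least {v = v} e v≡ {w} Xw with u , t≤u , u<d , eq ← complete e Xw
    with m≤n⇒m<n∨m≡n t≤u
  ... | inj₁ t<u = subst₂ _≤_ (sym v≡) eq (<⇒≤ (mono e ≤-refl t<u u<d))
  ... | inj₂ refl = ≤-reflexive (trans v≡ eq)

  -- By strict monotonicity only cell `t` holds the position of `v`, so deleting `v` amounts to
  -- raising the lower end of the interval.
  Enumerates-tail : (∀ {u v} → pos u ≡ pos v → u ≡ v) → ∀ {X : Subset n} {t d v} →
                    Enumerates pos (_∈ X) E t d → pos v ≡ E t →
                    Enumerates pos (_∈ X - v) E (suc t) d
  Enumerates-tail pos-inj {X} {t} {d} {v} e v≡ = record
    { sound = λ t<u u<d → let w , eq , w∈X = sound e (<⇒≤ t<u) u<d in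
        w , eq , x∈p∧x≢y⇒x∈p-y w∈X
          λ { refl → <-irrefl (trans (sym v≡) eq) (mono e ≤-refl t<u u<d) }
    ; complete = compl
    ; mono = λ t<u → mono e (<⇒≤ t<u) }
    where
    compl : ∀ {w} → w ∈ X - v → ∃[ u ] suc t ≤ u × u < d × E u ≡ pos w
    compl {w} w∈ with u , t≤u , u<d , eq ← complete e (p─q⊆p X ⁅ v ⁆ w∈)
      with m≤n⇒m<n∨m≡n t≤u
    ... | inj₁ t<u = u , t<u , u<d , eq
    ... | inj₂ refl = contradiction (pos-inj (trans (sym eq) (sym v≡))) (x∈p-y⇒x≢y X w∈)

  Enumerates-empty : ∀ {X : Fin n → Set} {t} → Enumerates pos X E t t → ∀ {v} → ¬ X v
  Enumerates-empty e Xv with u , t≤u , u<t , _ ← complete e Xv = <⇒≱ u<t t≤u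

  -- Peeling off the least position removes one element. The counters of the scanning loop are
  -- thereby identified with sizes of differences.
  Enumerates-card : (∀ {u v} → pos u ≡ pos v → u ≡ v) → ∀ r {t} {X : Subset n} →
                    Enumerates pos (_∈ X) E t (t + r) → r ≡ ∣ X ∣
  Enumerates-card pos-inj zero {t} {X} e =
    sym (trans (cong ∣_∣ (Empty-unique λ (v , v∈X) → Enumerates-empty e′ v∈X)) (∣⊥∣≡0 n))
    where e′ = subst (Enumerates pos (_∈ X) E t) (+-identityʳ t) e
  Enumerates-card pos-inj (suc r) {t} {X} e
    with v , v≡ , v∈X ← sound e ≤-refl (m<m+n t z<s) = sym (trans (∣p∣≡1+∣p-x∣ v∈X)
      (cong suc (sym (Enumerates-card pos-inj r (Enumerates-tail pos-inj e′ v≡)))))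
    where e′ = subst (Enumerates pos (_∈ X) E t) (+-suc t r) e

-- Array updates and growing an enumeration

update-same : ∀ {A : Set} (f : ℕ → A) i a → (f [ i ↦ a ]) i ≡ a
update-same f i a with i ≡ᵇ i in eq
... | true = refl
... | false with () ← subst T eq (≡⇒≡ᵇ i i refl)

update-other : ∀ {A : Set} (f : ℕ → A) {i j} a → i ≢ j → (f [ i ↦ a ]) j ≡ f j
update-other f {i} {j} a i≢j with i ≡ᵇ j in eq
... | true = contradiction (≡ᵇ⇒≡ i j (subst T (sym eq) tt)) i≢j
... | false = refl

-- The new position exceeds all earlier ones, so writing it in the next cell keeps the table
-- increasing.
Enumerates-snoc : ∀ {pos : Fin n → ℕ} {X Y : Fin n → Set} {E c i v} → Enumerates pos X E 0 c →
                  pos v ≡ i → (∀ {w} → X w → pos w < i) →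
                  (∀ {w} → X w → Y w) → Y v → (∀ {w} → Y w → X w ⊎ w ≡ v) →
                  Enumerates pos Y (E [ c ↦ i ]) 0 (suc c)
Enumerates-snoc {pos = pos} {X} {Y} {E} {c} {i} {v} e refl X<i X⇒Y Yv Y⇒X = record
  { sound = snd ; complete = compl ; mono = mon }
  where
  old : ∀ {u} → u < c → (E [ c ↦ i ]) u ≡ E u
  old u<c = update-other E {c} i (λ { refl → <-irrefl refl u<c })
  new : (E [ c ↦ i ]) c ≡ i
  new = update-same E c i
  snd : ∀ {u} → 0 ≤ u → u < suc c → ∃[ v ] pos v ≡ (E [ c ↦ i ]) u × Y v
  snd _ (s≤s u≤c) with m≤n⇒m<n∨m≡n u≤c
  ... | inj₁ u<c = let w , eq , Xw = sound e z≤n u<c in w , trans eq (sym (old u<c)) , X⇒Y Xw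
  ... | inj₂ refl = v , sym new , Yv
  compl : ∀ {v} → Y v → ∃[ u ] 0 ≤ u × u < suc c × (E [ c ↦ i ]) u ≡ pos v
  compl Yw with Y⇒X Yw
  ... | inj₁ Xw = let u , _ , u<c , eq = complete e Xw in u , z≤n , m<n⇒m<1+n u<c , trans (old u<c) eq
  ... | inj₂ refl = c , z≤n , n<1+n c , new
  mon : ∀ {u u′} → 0 ≤ u → u < u′ → u′ < suc c → (E [ c ↦ i ]) u < (E [ c ↦ i ]) u′
  mon {u} {u′} _ u<u′ (s≤s u′≤c) with m≤n⇒m<n∨m≡n u′≤c
  ... | inj₁ u′<c = subst₂ _<_ (sym (old (<-trans u<u′ u′<c))) (sym (old u′<c)) (mono e z≤n u<u′ u′<c)
  ... | inj₂ refl with w , eq , Xw ← sound e z≤n u<u′ =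
    subst₂ _<_ (trans eq (sym (old u<u′))) (sym new) (X<i Xw)

-- Token jumping sequences

-- The inductive counterpart of `TJSequence`: the construction grows a sequence at both ends,
-- rightward moves in front and leftward moves at the back.
data Walk (k : ℕ) (G : Graph n) : Subset n → Subset n → ℕ → Set where
  [_] : ∀ {I} → IsPathVertexCover k G I → Walk k G I I 0
  _∷_ : ∀ {I I′ J} → IsPathVertexCover k G I × TJStep I I′ → Walk k G I′ J ℓ → Walk k G I J (suc ℓ)

module _ {G : Graph n} where

  snoc : ∀ {I J J′} → Walk k G I J ℓ → TJStep J J′ → IsPathVertexCover k G J′ → Walk k G I J′ (suc ℓ)
  snoc [ c ] s c′ = (c , s) ∷ [ c′ ]
  snoc (cs ∷ w) s c′ = cs ∷ snoc w s c′

  -- f and g hold the vertices removed and added by the walk from index lo on.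
  Records : ∀ {I J} (f g : ℕ → ℕ) → ℕ → Walk k G I J ℓ → Set
  Records f g lo [ _ ] = Unit
  Records f g lo ((_ , s) ∷ w) =
    f lo ≡ toℕ (TJStep.x s) × g lo ≡ toℕ (TJStep.y s) × Records f g (suc lo) w

  Records-snoc : ∀ {I J J′ f g} lo (w : Walk k G I J ℓ) {s : TJStep J J′} {c′} → Records f g lo w →
                 f (lo + ℓ) ≡ toℕ (TJStep.x s) → g (lo + ℓ) ≡ toℕ (TJStep.y s) →
                 Records f g lo (snoc w s c′)
  Records-snoc {f = f} {g} lo [ c ] _ fe ge =
    trans (cong f (sym (+-identityʳ lo))) fe , trans (cong g (sym (+-identityʳ lo))) ge , tt
  Records-snoc {ℓ = suc ℓ} {f = f} {g} lo (cs ∷ w) (fx , gy , ms) fe ge =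
    fx , gy , Records-snoc (suc lo) w ms
      (trans (cong f (sym (+-suc lo ℓ))) fe) (trans (cong g (sym (+-suc lo ℓ))) ge)

  walkSet : ∀ {I J} → Walk k G I J ℓ → Fin (suc ℓ) → Subset n
  walkSet {I = I} w zero = I
  walkSet (_ ∷ w) (suc i) = walkSet w i

  walkStep : ∀ {I J} (w : Walk k G I J ℓ) i → TJStep (walkSet w (inject₁ i)) (walkSet w (suc i))
  walkStep ((_ , s) ∷ _) zero = s
  walkStep (_ ∷ w) (suc i) = walkStep w i

  toSequence : ∀ {I J} → Walk k G I J ℓ → TJSequence k G I J ℓ
  toSequence w = record
    { set = walkSet w ; cover = cover w ; first = refl ; last = last w ; step = walkStep w }
    where
    cover : ∀ {I J} (w : Walk k G I J ℓ) → ∀ i → IsPathVertexCover k G (walkSet w i)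
    cover [ c ] zero = c
    cover ((c , _) ∷ _) zero = c
    cover (_ ∷ w) (suc i) = cover w i
    last : ∀ {I J} (w : Walk k G I J ℓ) → walkSet w (fromℕ ℓ) ≡ J
    last [ _ ] = refl
    last (_ ∷ w) = last w

  Records-step : ∀ {I J f g} lo (w : Walk k G I J ℓ) → Records f g lo w → ∀ i →
                 f (lo + toℕ i) ≡ toℕ (TJStep.x (walkStep w i)) ×
                 g (lo + toℕ i) ≡ toℕ (TJStep.y (walkStep w i))
  Records-step {f = f} {g} lo ((_ , s) ∷ w) (fx , gy , _) zero =
    trans (cong f (+-identityʳ lo)) fx , trans (cong g (+-identityʳ lo)) gy
  Records-step {f = f} {g} lo (_ ∷ w) (_ , _ , ms) (suc i)
    with fx , gy ← Records-step (suc lo) w ms i =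
    trans (cong f (+-suc lo (toℕ i))) fx , trans (cong g (+-suc lo (toℕ i))) gy

module _ {G : Graph n} (φ : G ≅ pathGraph n) (A B : ℕ → ℕ) where
  private
    pos = position φ
    pos-inj = position-injective φ

  -- `A` and `B` hold positions whereas the output holds vertex labels. Positions are injective, so
  -- at most one `v` is meant.
  Labels : ℕ → ℕ → Set
  Labels l p = ∀ v → pos v ≡ p → l ≡ toℕ v

  -- The moves A u → B u with t ≤ u < t + r are laid out in the cells [lo, lo + r)
  -- of f and g: rightward ones in increasing order of u, followed by the other
  -- ones in decreasing order of u.
  Schedule : (f g : ℕ → ℕ) (t lo r : ℕ) → Set
  Schedule f g t lo zero = Unit
  Schedule f g t lo (suc r) =
    (A t < B t × Labels (f lo) (A t) × Labels (g lo) (B t) × Schedule f g (suc t) (suc lo) r)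
    ⊎ (¬ A t < B t × Labels (f (lo + r)) (A t) × Labels (g (lo + r)) (B t) × Schedule f g (suc t) lo r)

  -- Induction on the number of remaining moves, in step with `Schedule`: a rightward move is put in
  -- front of the remaining walk and takes cell `lo`, a leftward one is put behind it and takes cell
  -- `lo + r`. The upper end `d` stays fixed while `t` and `r` change.
  reconfigure : ∀ r t {d I J} → d ≡ t + r → IsPathVertexCover k G I → IsPathVertexCover k G J →
                Enumerates pos (_∈ I ─ J) A t d → Enumerates pos (_∈ J ─ I) B t d →
                Σ[ w ∈ Walk k G I J r ] (∀ {f g lo} → Schedule f g t lo r → Records f g lo w)
  reconfigure zero t {I = I} {J} d≡ coverI coverJ eA eB
    with refl ← trans d≡ (+-identityʳ t)
    with refl ← ⊆-antisym (p─q-empty⇒p⊆q I J (Enumerates-empty eA))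
                          (p─q-empty⇒p⊆q J I (Enumerates-empty eB)) = [ coverI ] , _
  reconfigure (suc r) t {I = I} {J} refl coverI coverJ eA eB
    with a , a≡ , a∈ ← sound eA ≤-refl (m<m+n t z<s)
       | b , b≡ , b∈ ← sound eB ≤-refl (m<m+n t z<s)
    with a∈I ← p─q⊆p I J a∈ | a∉J ← x∈p─q⇒x∉q I J a∈
       | b∈J ← p─q⊆p J I b∈ | b∉I ← x∈p─q⇒x∉q J I b∈
    with <-cmp (A t) (B t)
  -- Equal positions would give `a ≡ b`, although `b ∈ J` and `a ∉ J`.
  ... | tri≈ _ eq _ = contradiction
          (subst (_∈ J) (pos-inj (trans b≡ (trans (sym eq) (sym a≡)))) b∈J) a∉J
  ... | tri< A<B _ _
    with w , rec ← reconfigure r (suc t) (+-suc t r)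
           (jump-cover φ coverI coverJ a∉J (subst₂ _<_ (sym a≡) (sym b≡) A<B) (Enumerates-least eB b≡))
           coverJ
           (subst (λ X → Enumerates pos (_∈ X) A (suc t) _) (sym (jump-─ I J b∈J))
             (Enumerates-tail pos-inj eA a≡))
           (subst (λ X → Enumerates pos (_∈ X) B (suc t) _) (sym (─-jump I J a∉J))
             (Enumerates-tail pos-inj eB b≡))
    = ((coverI , jumpStep a∈I b∉I) ∷ w) , λ
        { (inj₁ (_ , fa , gb , sched)) → fa a a≡ , gb b b≡ , rec sched
        ; (inj₂ (A≮B , _)) → contradiction A<B A≮B }
  -- Here `I` and `J` exchange roles: the recursion leads from `I` to `jump J b a`, and reversing
  -- that jump is the last step.
  ... | tri> A≮B _ B<A
    with w , rec ← reconfigure r (suc t) (+-suc t r) coverI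
           (jump-cover φ coverJ coverI b∉I (subst₂ _<_ (sym b≡) (sym a≡) B<A) (Enumerates-least eA a≡))
           (subst (λ X → Enumerates pos (_∈ X) A (suc t) _) (sym (─-jump J I b∉I))
             (Enumerates-tail pos-inj eA a≡))
           (subst (λ X → Enumerates pos (_∈ X) B (suc t) _) (sym (jump-─ J I a∈I))
             (Enumerates-tail pos-inj eB b≡))
    = snoc w (reverseStep (jumpStep b∈J a∉J)) coverJ , λ
        { (inj₁ (A<B , _)) → contradiction A<B A≮B
        ; (inj₂ (_ , fa , gb , sched)) → Records-snoc _ w (rec sched) (fa a a≡) (gb b b≡) }

-- Reasoning about programs

Runs : Program → State → (State → Set) → ℕ → Set
Runs p s Q b = ∃[ s′ ] ∃[ t ] (p , s ⇓ s′ , t) × t ≤ b × Q s′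

infixr 5 _andThen_

_andThen_ : ∀ {p p′ s Q R b b′} → Runs p s Q b → (∀ s′ → Q s′ → Runs p′ s′ R b′) →
            Runs (p ⨾ p′) s R (b + b′)
(_ , _ , run , t≤ , q) andThen f with s″ , _ , run′ , t′≤ , r ← f _ q =
  s″ , _ , seq run run′ , +-mono-≤ t≤ t′≤ , r

Runs-map : ∀ {p s Q R b} → (∀ s′ → Q s′ → R s′) → Runs p s Q b → Runs p s R b
Runs-map f (s′ , t , run , t≤ , q) = s′ , t , run , t≤ , f s′ q

-- Weakest preconditions are for loop-free code only, hence `Empty` at `while`; loops go through
-- `Runs-for`.
wp : Program → (State → Set) → State → Set
wp skip           Q s = Q s
wp (const r m)    Q s = Q (setReg r m s)
wp (copy r q)     Q s = Q (setReg r (reg s q) s)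
wp (inc r)        Q s = Q (setReg r (suc (reg s r)) s)
wp (dec r)        Q s = Q (setReg r (pred (reg s r)) s)
wp (load r a q)   Q s = Q (setReg r (arr s a (reg s q)) s)
wp (store a q r)  Q s = Q (setCell a (reg s q) (reg s r) s)
wp (p ⨾ p′)       Q s = wp p (wp p′ Q) s
wp (branch b p p′) Q s = (test b s ≡ true → wp p Q s) × (test b s ≡ false → wp p′ Q s)
wp (while _ _)    Q s = Empty

-- Charging both branches gives an upper bound without a maximum. The value at `while` is a
-- placeholder, since `wp` is empty there.
cost : Program → ℕ
cost (p ⨾ p′)        = cost p + cost p′
cost (branch _ p p′) = suc (cost p + cost p′)
cost _               = 1

wp-sound : ∀ p {Q s} → wp p Q s → Runs p s Q (cost p)
wp-sound skip          q = _ , _ , skip , ≤-refl , q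
wp-sound (const _ _)   q = _ , _ , const , ≤-refl , q
wp-sound (copy _ _)    q = _ , _ , copy , ≤-refl , q
wp-sound (inc _)       q = _ , _ , inc , ≤-refl , q
wp-sound (dec _)       q = _ , _ , dec , ≤-refl , q
wp-sound (load _ _ _)  q = _ , _ , load , ≤-refl , q
wp-sound (store _ _ _) q = _ , _ , store , ≤-refl , q
wp-sound (p ⨾ p′) q = wp-sound p q andThen λ _ → wp-sound p′
wp-sound (branch b p p′) {s = s} (q , q′) with test b s in eq
... | true  = let s′ , _ , run , t≤ , r = wp-sound p (q refl) in
              s′ , _ , branch-true eq run , s≤s (m≤n⇒m≤n+o (cost p′) t≤) , r
... | false = let s′ , _ , run , t≤ , r = wp-sound p′ (q′ refl) in
              s′ , _ , branch-false eq run , s≤s (m≤n⇒m≤o+n (cost p) t≤) , r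

for : Register → Register → Program → Program
for i r p = const i 0 ⨾ while (i ≺ r) (p ⨾ inc i)

<ᵇ-true : ∀ {i j} → i < j → (i <ᵇ j) ≡ true
<ᵇ-true {i} {j} i<j with i <ᵇ j | <⇒<ᵇ i<j
... | true | _ = refl

<ᵇ-true⁻ : ∀ {i j} → (i <ᵇ j) ≡ true → i < j
<ᵇ-true⁻ {i} {j} eq = <ᵇ⇒< i j (subst T (sym eq) tt)

<ᵇ-false⁻ : ∀ {i j} → (i <ᵇ j) ≡ false → ¬ i < j
<ᵇ-false⁻ eq i<j with () ← trans (sym (<ᵇ-true i<j)) eq

<ᵇ-irrefl : ∀ i → (i <ᵇ i) ≡ false
<ᵇ-irrefl zero = refl
<ᵇ-irrefl (suc i) = <ᵇ-irrefl i

-- The invariant rule. The 2 pays for resetting the counter and for the final failing test; each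
-- round costs one test, the body and one increment.
Runs-for : ∀ {i r} p (Inv : ℕ → State → Set) {N s} →
           (∀ j s → Inv j s → reg s i ≡ j × reg s r ≡ N) →
           (∀ j s → j < N → Inv j s → wp (p ⨾ inc i) (Inv (suc j)) s) →
           Inv 0 (setReg i 0 s) →
           Runs (for i r p) s (Inv N) (2 + N * suc (cost p + 1))
Runs-for {i} {r} p Inv {N} {s} regs step inv₀ =
  wp-sound (const i 0) {Inv 0} {s} inv₀ andThen λ _ inv → loop N refl inv
  where
  -- Induction on the number `m` of rounds left.
  loop : ∀ m {j s} → j + m ≡ N → Inv j s →
         Runs (while (i ≺ r) (p ⨾ inc i)) s (Inv N) (1 + m * suc (cost p + 1))
  loop zero {j} {s} j≡N inv with refl ← trans (sym (+-identityʳ j)) j≡N =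
    s , _ , while-false test-false , ≤-refl , inv
    where
    test-false = trans (cong₂ _<ᵇ_ (proj₁ (regs _ _ inv)) (proj₂ (regs _ _ inv))) (<ᵇ-irrefl j)
  loop (suc m) {j} {s} refl inv
    with s′ , t , run , t≤ , inv′ ← wp-sound (p ⨾ inc i) (step _ _ (m<m+n j z<s) inv)
    with s″ , t′ , run′ , t′≤ , inv″ ← loop m (sym (+-suc j m)) inv′ =
    s″ , _ , while-true test-true run run′ , time , inv″
    where
    test-true =
      trans (cong₂ _<ᵇ_ (proj₁ (regs _ _ inv)) (proj₂ (regs _ _ inv))) (<ᵇ-true (m<m+n j z<s))
    time : suc (t + t′) ≤ 1 + (suc (cost p + 1) + m * suc (cost p + 1))
    time = s≤s (≤-trans (+-mono-≤ t≤ t′≤) (≤-reflexive (+-suc (cost p + 1) _)))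

-- The algorithm

-- Register 2 counts the iterations of every loop.  Otherwise, in findEnd and walk,
-- 4 holds the current vertex, 5 the previous one and 3 the constant 2; in
-- compareSets, lengthReg and 3 count the positions found so far in I ─ J and in
-- J ─ I; in schedule, the free output cells are those from 3 up to but excluding 4.
orderArr sourcePosArr targetPosArr : Array
orderArr     = 7
sourcePosArr = 8
targetPosArr = 9

findEndBody walkBody compareBody scheduleBody : Program
findEndBody = load 6 degreeArr 2 ⨾ branch (6 ≺ 3) (copy 4 2) skip
walkBody =
  store orderArr 2 4 ⨾ load 6 startArr 4 ⨾ load 7 neighbourArr 6 ⨾
  -- If the first listed neighbour is the previous vertex, the second is the next one. At the far
  -- end of the path the value read may be arbitrary, but the loop ends there.
  branch (7 ≐ 5) (inc 6 ⨾ load 7 neighbourArr 6) skip ⨾ copy 5 4 ⨾ copy 4 7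
compareBody =
  load 4 orderArr 2 ⨾ load 5 sourceArr 4 ⨾ load 6 targetArr 4 ⨾
  -- On bits, `6 ≺ 5` means being in the source set and not in the target set.
  branch (6 ≺ 5) (store sourcePosArr 1 2 ⨾ inc 1)
    (branch (5 ≺ 6) (store targetPosArr 3 2 ⨾ inc 3) skip)
scheduleBody =
  load 5 sourcePosArr 2 ⨾ load 6 targetPosArr 2 ⨾
  branch (5 ≺ 6)
    (load 5 orderArr 5 ⨾ load 6 orderArr 6 ⨾
     store removedArr 3 5 ⨾ store addedArr 3 6 ⨾ inc 3)
    (load 5 orderArr 5 ⨾ load 6 orderArr 6 ⨾
     -- Register 4 is an exclusive bound, so it is lowered before the cell is written.
     dec 4 ⨾ store removedArr 4 5 ⨾ store addedArr 4 6)

findEnd walk compareSets schedule : Program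
findEnd  = const 3 2 ⨾ for 2 sizeReg findEndBody
-- The first vertex poses as its own predecessor; not being its own neighbour, it never makes the
-- first test succeed wrongly.
walk     = copy 5 4 ⨾ for 2 sizeReg walkBody
compareSets = (const lengthReg 0 ⨾ const 3 0) ⨾ for 2 sizeReg compareBody
schedule = (const 3 0 ⨾ copy 4 lengthReg) ⨾ for 2 lengthReg scheduleBody

program : Program
program = findEnd ⨾ walk ⨾ compareSets ⨾ schedule

loopTime : Program → ℕ → ℕ
loopTime p N = 2 + N * suc (cost p + 1)

-- One tuple makes preservation of the whole input a single equation. The phases write only to other
-- registers and arrays, so it persists definitionally.
inputs : State → ℕ × (ℕ → ℕ) × (ℕ → ℕ) × (ℕ → ℕ) × (ℕ → ℕ) × (ℕ → ℕ)
inputs s = reg s sizeReg , arr s startArr , arr s degreeArr , arr s neighbourArr ,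
           arr s sourceArr , arr s targetArr

-- Orientations of a path and its adjacency lists

vertexAt : {G : Graph n} (φ : G ≅ pathGraph n) → ∀ {i} → i < n → ∃[ v ] position φ v ≡ i
vertexAt φ i<n = from (fromℕ< i<n) ,
  trans (cong toℕ (strictlyInverseˡ (fromℕ< i<n))) (Fin.toℕ-fromℕ< i<n)
  where open Inverse (_≅_.vertices φ)

position<n : {G : Graph n} (φ : G ≅ pathGraph n) → ∀ v → position φ v < n
position<n φ v = Fin.toℕ<n (Inverse.to (_≅_.vertices φ) v)

-- The search for an end may find either one; reversal places the one found at position 0.
reverse : {G : Graph n} → G ≅ pathGraph n → G ≅ pathGraph n
reverse {n = n} {G} φ = record
  { vertices = mk↔ₛ′ (opposite ∘ to) (from ∘ opposite)
      (λ i → trans (cong opposite (strictlyInverseˡ (opposite i))) (Fin.opposite-involutive i))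
      (λ v → trans (cong from (Fin.opposite-involutive (to v))) (strictlyInverseʳ v))
  ; edges = λ u v → mk⇔ (λ e → flip (to u) (to v) (Equivalence.to (edges u v) e))
      (λ e → Equivalence.from (edges u v)
        (subst₂ (Graph._~_ (pathGraph n))
          (Fin.opposite-involutive (to u)) (Fin.opposite-involutive (to v))
          (flip (opposite (to u)) (opposite (to v)) e))) }
  where
  open _≅_ φ
  open Inverse vertices
  half : ∀ (i j : Fin n) → suc (toℕ i) ≡ toℕ j → suc (toℕ (opposite j)) ≡ toℕ (opposite i)
  half i j e = begin
    suc (toℕ (opposite j))  ≡⟨ cong suc (Fin.opposite-prop j) ⟩
    suc (n ∸ suc (toℕ j))   ≡⟨ +-∸-assoc 1 (Fin.toℕ<n j) ⟨
    n ∸ toℕ j               ≡⟨ cong (n ∸_) e ⟨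
    n ∸ suc (toℕ i)         ≡⟨ Fin.opposite-prop i ⟨
    toℕ (opposite i)        ∎
    where open ≡-Reasoning
  flip : ∀ (i j : Fin n) → Graph._~_ (pathGraph n) i j →
         Graph._~_ (pathGraph n) (opposite i) (opposite j)
  flip i j (inj₁ e) = inj₂ (half i j e)
  flip i j (inj₂ e) = inj₁ (half j i e)

two-members : ∀ {A : Set} {x y : A} {xs : List A} → x List.∈ xs → y List.∈ xs → x ≢ y → 2 ≤ length xs
two-members {xs = _ ∷ []} (here refl) (here refl) x≢y = contradiction refl x≢y
two-members {xs = _ ∷ _ ∷ _} _ _ _ = s≤s (s≤s z≤n)

constant⇒length≤1 : ∀ {A : Set} {xs : List A} → Unique xs →
                    (∀ {x y} → x List.∈ xs → y List.∈ xs → x ≡ y) → length xs ≤ 1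
constant⇒length≤1 {xs = []} _ _ = z≤n
constant⇒length≤1 {xs = _ ∷ []} _ _ = ≤-refl
constant⇒length≤1 {xs = _ ∷ _ ∷ _} ((x≢y ∷ _) ∷ _) eq =
  contradiction (eq (here refl) (there (here refl))) x≢y

-- The list l contains the vertices next to position i, and f holds it from b on;
-- p is the label of the vertex before position i, if there is one.
next-neighbour : ∀ {pos : Fin n → ℕ} {l : List (Fin n)} {f : ℕ → ℕ} {b p i u} →
                 (∀ {x y} → pos x ≡ pos y → x ≡ y) →
                 Unique l → (∀ j → f (b + toℕ j) ≡ toℕ (List.lookup l j)) →
                 (∀ {x} → x List.∈ l → suc i ≡ pos x ⊎ suc (pos x) ≡ i) →
                 (∀ x → suc (pos x) ≡ i → p ≡ toℕ x) → pos u ≡ suc i → u List.∈ l → p ≢ toℕ u →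
                 ((f b ≡ᵇ p) ≡ true → f (suc b) ≡ toℕ u) × ((f b ≡ᵇ p) ≡ false → f b ≡ toℕ u)
next-neighbour {pos = pos} {x ∷ l} {f} {b} {p} {i} {u} inj uniq cells nbrs before u≡ u∈ p≢u =
  (λ same → second (≡ᵇ⇒≡ (f b) p (subst T (sym same) tt)) uniq cells nbrs u∈) , first
  where
  cell₀ = trans (cong f (sym (+-identityʳ b))) (cells zero)
  after : ∀ {y} → suc i ≡ pos y → y ≡ u
  after e = inj (trans (sym e) (sym u≡))
  -- A neighbour on the near side would have label `p`, so a different entry lies ahead.
  first : (f b ≡ᵇ p) ≡ false → f b ≡ toℕ u
  first differ with nbrs {x} (here refl)
  ... | inj₁ e = trans cell₀ (cong toℕ (after e))
  ... | inj₂ e with () ← subst T differ (≡⇒≡ᵇ (f b) p (trans cell₀ (sym (before x e))))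
  -- As `p` is not the label of `u`, the list has a second entry; by uniqueness that entry is not
  -- the previous vertex again.
  second : ∀ {l} → f b ≡ p → Unique (x ∷ l) → (∀ j → f (b + toℕ j) ≡ toℕ (List.lookup (x ∷ l) j)) →
           (∀ {y} → y List.∈ x ∷ l → suc i ≡ pos y ⊎ suc (pos y) ≡ i) → u List.∈ x ∷ l →
           f (suc b) ≡ toℕ u
  second same _ _ _ (here refl) = contradiction (trans (sym same) cell₀) p≢u
  second {y ∷ l} same ((x≢y ∷ _) ∷ _) cells nbrs (there _) with nbrs {y} (there (here refl))
  ... | inj₁ e = trans (trans (cong f (+-comm 1 b)) (cells (suc zero))) (cong toℕ (after e))
  ... | inj₂ e = contradiction
    (Fin.toℕ-injective (trans (sym cell₀) (trans same (before y e)))) x≢y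

-- Scanning a path for the members of a set

module _ {pos : Fin n → ℕ} {X : Subset n} {E : ℕ → ℕ} {c : ℕ} {v : Fin n}
         (pos-inj : ∀ {x y} → pos x ≡ pos y → x ≡ y) where

  Below : ℕ → Fin n → Set
  Below i w = w ∈ X × pos w < i

  Enumerates-∈ : v ∈ X → Enumerates pos (Below (pos v)) E 0 c →
                 Enumerates pos (Below (suc (pos v))) (E [ c ↦ pos v ]) 0 (suc c)
  Enumerates-∈ v∈X e = Enumerates-snoc e refl proj₂ (λ (w∈X , w<) → w∈X , m<n⇒m<1+n w<) (v∈X , ≤-refl)
    λ (w∈X , w≤) →
      [ (λ w<v → inj₁ (w∈X , w<v)) , (λ w≡v → inj₂ (pos-inj w≡v)) ]′ (m≤n⇒m<n∨m≡n (s≤s⁻¹ w≤))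

  Enumerates-∉ : v ∉ X → Enumerates pos (Below (pos v)) E 0 c →
                 Enumerates pos (Below (suc (pos v))) E 0 c
  Enumerates-∉ v∉X = Enumerates-resp (λ (w∈X , w<) → w∈X , m<n⇒m<1+n w<)
    λ (w∈X , w≤) → w∈X , ≤∧≢⇒< (s≤s⁻¹ w≤) λ w≡v → v∉X (subst (_∈ X) (pos-inj w≡v) w∈X)

module _ {G : Graph n} (φ : G ≅ pathGraph n) where
  private
    pos = position φ
    pos-inj : ∀ {u v} → pos u ≡ pos v → u ≡ v
    pos-inj = position-injective φ

  -- The scan of `compareSets` without a machine: it supplies the tables for reconfiguring sets of
  -- equal size.
  enumeration : ∀ X → ∃[ E ] ∃[ c ] Enumerates pos (_∈ X) E 0 c
  enumeration X = let E , c , e = below n ≤-refl in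
    E , c , Enumerates-resp proj₁ (λ {v} v∈X → v∈X , position<n φ v) e
    where
    below : ∀ i → i ≤ n → ∃[ E ] ∃[ c ] Enumerates pos (λ v → v ∈ X × pos v < i) E 0 c
    below zero _ = id , 0 , record { sound = λ _ () ; complete = λ () ; mono = λ _ _ () }
    below (suc i) i<n with v , refl ← vertexAt φ i<n with E , c , e ← below (pos v) (<⇒≤ i<n) | v ∈? X
    ... | yes v∈X = _ , _ , Enumerates-∈ pos-inj v∈X e
    ... | no v∉X = _ , _ , Enumerates-∉ pos-inj v∉X e

  Enumerates-same-size : ∀ {I J : Subset n} {A B c d} → ∣ I ∣ ≡ ∣ J ∣ →
    Enumerates pos (_∈ I ─ J) A 0 c → Enumerates pos (_∈ J ─ I) B 0 d → c ≡ d
  Enumerates-same-size {I} {J} {c = c} {d} cardIJ eA eB = begin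
    c           ≡⟨ Enumerates-card pos-inj _ eA ⟩
    ∣ I ─ J ∣   ≡⟨ +-cancelˡ-≡ ∣ J ∣ _ _
                     (trans (sym (∣p∣+∣q─p∣≡∣q∣+∣p─q∣ I J)) (cong (_+ ∣ J ─ I ∣) cardIJ)) ⟩
    ∣ J ─ I ∣   ≡⟨ Enumerates-card pos-inj _ eB ⟨
    d           ∎
    where open ≡-Reasoning

  card⇒reconfigurable : ∀ {I J} → IsPathVertexCover k G I → IsPathVertexCover k G J →
                        ∣ I ∣ ≡ ∣ J ∣ → Reconfigurable k G I J
  card⇒reconfigurable {I = I} {J} coverI coverJ cardIJ
    with A , c , eA ← enumeration (I ─ J) | B , d , eB ← enumeration (J ─ I)
    with refl ← Enumerates-same-size cardIJ eA eB =
    c , toSequence (proj₁ (reconfigure φ A B c 0 refl coverI coverJ eA eB))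

bit : Bool → ℕ
bit b = if b then 1 else 0

-- The only strict inequality between bits is 0 < 1.
bit-<-true : ∀ {p q : Subset n} v → (bit (lookup q v) <ᵇ bit (lookup p v)) ≡ true → v ∈ p ─ q
bit-<-true {p = p} {q} v less with lookup p v in p≡ | lookup q v in q≡
... | true | false = x∈p∧x∉q⇒x∈p─q (lookup⇒[]= v p p≡)
  λ v∈q → contradiction (trans (sym q≡) ([]=⇒lookup v∈q)) λ ()
bit-<-true v () | true | true
bit-<-true v () | false | true
bit-<-true v () | false | false

bit-<-false : ∀ {p q : Subset n} v → (bit (lookup q v) <ᵇ bit (lookup p v)) ≡ false → v ∉ p ─ q
bit-<-false {p = p} {q} v notless v∈ with lookup q v in q≡
... | true = x∈p─q⇒x∉q p q v∈ (lookup⇒[]= v q q≡)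
... | false with () ← trans (sym notless) (cong (λ b → 0 <ᵇ bit b) ([]=⇒lookup (p─q⊆p p q v∈)))

-- Correctness of the four phases

module Correctness {n} {G : Graph n} {I J : Subset n} {s₀ : State} (enc : Encodes G I J s₀) where
  open Encodes enc

  module _ (s : State) (kept : inputs s ≡ inputs s₀) where
    size′ : reg s sizeReg ≡ n
    size′ = trans (cong proj₁ kept) size

    degree′ : ∀ v → arr s degreeArr (toℕ v) ≡ length (adj v)
    degree′ v = trans (cong (λ (_ , _ , a , _) → a (toℕ v)) kept) (degree v)

    neighbour′ : ∀ v i → arr s neighbourArr (arr s startArr (toℕ v) + toℕ i) ≡
                 toℕ (List.lookup (adj v) i)
    neighbour′ v i =
      trans (cong (λ (_ , a , _ , b , _) → b (a (toℕ v) + toℕ i)) kept) (neighbour v i)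

    source′ : ∀ v → arr s sourceArr (toℕ v) ≡ (if lookup I v then 1 else 0)
    source′ v = trans (cong (λ (_ , _ , _ , _ , a , _) → a (toℕ v)) kept) (source v)

    target′ : ∀ v → arr s targetArr (toℕ v) ≡ (if lookup J v then 1 else 0)
    target′ v = trans (cong (λ (_ , _ , _ , _ , _ , a) → a (toℕ v)) kept) (target v)

  adjacent-positions : (φ : G ≅ pathGraph n) → ∀ {v w} → w List.∈ adj v →
                       suc (position φ v) ≡ position φ w ⊎ suc (position φ w) ≡ position φ v
  adjacent-positions φ {v} {w} w∈ = Equivalence.to (_≅_.edges φ v w) (Equivalence.to (adj-edges v w) w∈)

  successor∈adj : (φ : G ≅ pathGraph n) → ∀ {v w} → suc (position φ v) ≡ position φ w → w List.∈ adj v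
  successor∈adj φ {v} {w} e =
    Equivalence.from (adj-edges v w) (Equivalence.from (_≅_.edges φ v w) (inj₁ e))

  predecessor∈adj : (φ : G ≅ pathGraph n) → ∀ {v w} → suc (position φ w) ≡ position φ v → w List.∈ adj v
  predecessor∈adj φ {v} {w} e =
    Equivalence.from (adj-edges v w) (Equivalence.from (_≅_.edges φ v w) (inj₂ e))

  -- All neighbours of the vertex at position 0 are at position 1.
  start-degree : (φ : G ≅ pathGraph n) → ∀ {v} → position φ v ≡ 0 → length (adj v) < 2
  start-degree φ {v} v≡0 = s≤s (constant⇒length≤1 (adj-unique v)
    λ x∈ y∈ → position-injective φ (trans (sym (next x∈)) (next y∈)))
    where
    next : ∀ {x} → x List.∈ adj v → suc (position φ v) ≡ position φ x
    next x∈ with adjacent-positions φ x∈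
    ... | inj₁ e = e
    ... | inj₂ e with () ← trans e v≡0

  -- An inner vertex has two distinct neighbours, so low degree forces an end: position 0, or the
  -- last one, which reversal turns into 0.
  oriented : (φ : G ≅ pathGraph n) → ∀ {v} → length (adj v) < 2 →
             Σ[ ψ ∈ G ≅ pathGraph n ] position ψ v ≡ 0
  oriented φ {v} deg<2 with position φ v in eq | m≤n⇒m<n∨m≡n (position<n φ v)
  ... | zero | _ = φ , eq
  ... | suc i | inj₂ last = reverse φ , (begin
      toℕ (opposite (Inverse.to (_≅_.vertices φ) v))  ≡⟨ Fin.opposite-prop _ ⟩
      n ∸ suc (position φ v)                          ≡⟨ cong (n ∸_) (trans (cong suc eq) last) ⟩
      n ∸ n                                           ≡⟨ n∸n≡0 n ⟩
      0                                               ∎)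
    where open ≡-Reasoning
  ... | suc i | inj₁ inner
    with u , u≡ ← vertexAt φ inner
       | w , w≡ ← vertexAt φ (<-trans (≤-reflexive (sym eq)) (position<n φ v)) =
    contradiction (two-members (successor∈adj φ (trans (cong suc eq) (sym u≡)))
                               (predecessor∈adj φ (trans (cong suc w≡) (sym eq)))
      λ { refl → m+1+n≢m i (trans (+-comm i 2) (trans (sym u≡) w≡)) }) (<⇒≱ deg<2)

  -- The orientation is existential because it depends on which end is found; for `n` = 0 the
  -- condition on register 4 is vacuous.
  EndFound : State → Set
  EndFound s = inputs s ≡ inputs s₀ ×
    Σ[ φ ∈ G ≅ pathGraph n ] (∀ v → position φ v ≡ 0 → reg s 4 ≡ toℕ v)

  findEnd-correct : G ≅ pathGraph n → ∀ s → inputs s ≡ inputs s₀ →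
                    Runs findEnd s EndFound (1 + loopTime findEndBody n)
  findEnd-correct φ s kept = wp-sound (const 3 2)
      {λ s → inputs s ≡ inputs s₀ × reg s 3 ≡ 2} {s} (kept , refl)
    andThen λ _ (kept , two) → Runs-map conclude (Runs-for findEndBody Inv
      (λ _ s (kept , i≡ , _) → i≡ , size′ s kept) step (kept , refl , two , λ _ ()))
    where
    Inv : ℕ → State → Set
    Inv j s = inputs s ≡ inputs s₀ × reg s 2 ≡ j × reg s 3 ≡ 2 ×
      -- Register 4 is constrained only once a vertex of degree below 2 has been scanned.
      (∀ v → toℕ v < j → length (adj v) < 2 → ∃[ w ] reg s 4 ≡ toℕ w × length (adj w) < 2)
    step : ∀ j s → j < n → Inv j s → wp (findEndBody ⨾ inc 2) (Inv (suc j)) s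
    step _ s j<n (kept , refl , two , found) =
      (λ small → kept , refl , two , λ _ _ _ →
        v , sym v≡ , subst₂ _<_ deg≡ two (<ᵇ-true⁻ small)) ,
      (λ large → kept , refl , two , λ u u≤ deg<2 → found u
        (≤∧≢⇒< (s≤s⁻¹ u≤) λ u≡ → <ᵇ-false⁻ large
          (subst₂ _<_ (sym (trans (cong (arr s degreeArr) (sym u≡)) (degree′ s kept u)))
            (sym two) deg<2))
        deg<2)
      where
      v = fromℕ< j<n
      v≡ = Fin.toℕ-fromℕ< j<n
      deg≡ = trans (cong (arr s degreeArr) (sym v≡)) (degree′ s kept v)
    conclude : ∀ s → Inv n s → EndFound s
    conclude _ (kept , _ , _ , found) with 0 <? n
    ... | no n≯0 = kept , φ , λ v _ → contradiction (≤-<-trans z≤n (Fin.toℕ<n v)) n≯0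
    ... | yes 0<n
      -- The vertex at position 0 shows that the scan succeeds, but the vertex `w` it leaves may be
      -- the other end.
      with v , v≡0 ← vertexAt φ 0<n
      with w , w≡ , deg<2 ← found v (Fin.toℕ<n v) (start-degree φ v≡0)
      with ψ , ψw≡0 ← oriented φ deg<2 =
      kept , ψ , λ u ψu≡0 → trans w≡ (cong toℕ (position-injective ψ (trans ψw≡0 (sym ψu≡0))))

  module _ (φ : G ≅ pathGraph n) where
    private
      pos = position φ
      pos-inj : ∀ {u v} → pos u ≡ pos v → u ≡ v
      pos-inj = position-injective φ

    Ordered : State → Set
    Ordered s = inputs s ≡ inputs s₀ × (∀ v → arr s orderArr (pos v) ≡ toℕ v)

    walk-correct : ∀ s → inputs s ≡ inputs s₀ → (∀ v → pos v ≡ 0 → reg s 4 ≡ toℕ v) →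
                   Runs walk s Ordered (1 + loopTime walkBody n)
    walk-correct s kept start = wp-sound (copy 5 4)
        {λ s → inputs s ≡ inputs s₀ × (∀ v → pos v ≡ 0 → reg s 4 ≡ toℕ v) × reg s 5 ≡ reg s 4}
        {s} (kept , start , refl)
      andThen λ s (kept , start , prev≡) → Runs-map
        (λ _ (kept , _ , order , _) → kept , λ v → order v (position<n φ v))
        (Runs-for walkBody Inv (λ _ s (kept , i≡ , _) → i≡ , size′ s kept) step
          (kept , refl , (λ _ ()) , start , (λ _ ()) ,
            λ u u≡1 prev≡u → distinct-start s start prev≡ u≡1 prev≡u))
      where
      Inv : ℕ → State → Set
      Inv j s = inputs s ≡ inputs s₀ × reg s 2 ≡ j ×
        (∀ v → pos v < j → arr s orderArr (pos v) ≡ toℕ v) ×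
        (∀ v → pos v ≡ j → reg s 4 ≡ toℕ v) ×
        (∀ v → suc (pos v) ≡ j → reg s 5 ≡ toℕ v) ×
        -- For `j` = 0 the preceding clause is vacuous; this one still keeps register 5 from
        -- matching the next vertex.
        (∀ v → pos v ≡ suc j → reg s 5 ≢ toℕ v)
      step : ∀ j s → j < n → Inv j s → wp (walkBody ⨾ inc 2) (Inv (suc j)) s
      step j s j<n (kept , refl , order , cur , prev , prev≢) with v , v≡ ← vertexAt φ j<n =
        (λ same → kept , refl , order′ , (λ u u≡ → proj₁ (next u u≡) same) , prev′ , prev≢′) ,
        (λ differ → kept , refl , order′ , (λ u u≡ → proj₂ (next u u≡) differ) , prev′ , prev≢′)
        where
        cv : reg s 4 ≡ toℕ v
        cv = cur v v≡
        order′ : ∀ u → pos u < suc j → (arr s orderArr [ j ↦ reg s 4 ]) (pos u) ≡ toℕ u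
        order′ u (s≤s u≤j) with m≤n⇒m<n∨m≡n u≤j
        ... | inj₁ u<j = trans (update-other (arr s orderArr) (reg s 4) (<⇒≢ u<j ∘ sym)) (order u u<j)
        ... | inj₂ u≡j = trans (cong (arr s orderArr [ j ↦ reg s 4 ]) u≡j)
                           (trans (update-same (arr s orderArr) j (reg s 4)) (cur u u≡j))
        next : ∀ u → pos u ≡ suc j →
               let b = arr s startArr (reg s 4) ; f = arr s neighbourArr in
               ((f b ≡ᵇ reg s 5) ≡ true → f (suc b) ≡ toℕ u) × ((f b ≡ᵇ reg s 5) ≡ false → f b ≡ toℕ u)
        next u u≡ = next-neighbour {f = arr s neighbourArr} {arr s startArr (reg s 4)}
          pos-inj (adj-unique v)
          (subst (λ c → ∀ j → arr s neighbourArr (arr s startArr c + toℕ j) ≡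
                       toℕ (List.lookup (adj v) j))
            (sym cv) (neighbour′ s kept v))
          (λ {x} x∈ → subst (λ p → suc p ≡ pos x ⊎ suc (pos x) ≡ p) v≡ (adjacent-positions φ x∈))
          prev u≡ (successor∈adj φ (trans (cong suc v≡) (sym u≡))) (prev≢ u u≡)
        prev′ : ∀ u → suc (pos u) ≡ suc j → reg s 4 ≡ toℕ u
        prev′ u e = cur u (suc-injective e)
        prev≢′ : ∀ u → pos u ≡ suc (suc j) → reg s 4 ≢ toℕ u
        prev≢′ u u≡ e with refl ← Fin.toℕ-injective (trans (sym cv) e) =
          m≢1+n+m j {1} (trans (sym v≡) u≡)
      distinct-start : ∀ s {u} → (∀ v → pos v ≡ 0 → reg s 4 ≡ toℕ v) → reg s 5 ≡ reg s 4 →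
                       pos u ≡ 1 → reg s 5 ≢ toℕ u
      distinct-start _ {u} start prev≡ u≡1 prev≡u
        with w , w≡0 ← vertexAt φ (≤-<-trans z≤n (position<n φ u))
        with refl ← Fin.toℕ-injective (trans (sym (start w w≡0)) (trans (sym prev≡) prev≡u))
        with () ← trans (sym w≡0) u≡1

    Compared : State → Set
    Compared s = (∀ v → arr s orderArr (pos v) ≡ toℕ v) ×
      Enumerates pos (_∈ I ─ J) (arr s sourcePosArr) 0 (reg s lengthReg) ×
      Enumerates pos (_∈ J ─ I) (arr s targetPosArr) 0 (reg s 3)

    -- The scan follows `orderArr`, so positions are found in increasing order and each new one may
    -- be appended to its table.
    compare-correct : ∀ s → Ordered s → Runs compareSets s Compared (2 + loopTime compareBody n)
    compare-correct s (kept , order) = wp-sound (const lengthReg 0 ⨾ const 3 0)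
        {λ s → Ordered s × reg s lengthReg ≡ 0 × reg s 3 ≡ 0} {s} ((kept , order) , refl , refl)
      andThen λ s ((kept , order) , a≡0 , b≡0) → Runs-map
        (λ _ (_ , _ , order , eA , eB) → order , all eA , all eB)
        (Runs-for compareBody Inv (λ _ s (kept , i≡ , _) → i≡ , size′ s kept) step
          (kept , refl , order ,
            subst (Enumerates pos _ _ 0) (sym a≡0) none , subst (Enumerates pos _ _ 0) (sym b≡0) none))
      where
      Inv : ℕ → State → Set
      Inv j s = inputs s ≡ inputs s₀ × reg s 2 ≡ j × (∀ v → arr s orderArr (pos v) ≡ toℕ v) ×
        Enumerates pos (λ v → v ∈ I ─ J × pos v < j) (arr s sourcePosArr) 0 (reg s lengthReg) ×
        Enumerates pos (λ v → v ∈ J ─ I × pos v < j) (arr s targetPosArr) 0 (reg s 3)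
      all : ∀ {X : Subset n} {E c} → Enumerates pos (λ v → v ∈ X × pos v < n) E 0 c →
            Enumerates pos (_∈ X) E 0 c
      all = Enumerates-resp proj₁ (λ {v} v∈X → v∈X , position<n φ v)
      none : ∀ {X : Subset n} {E} → Enumerates pos (λ v → v ∈ X × pos v < 0) E 0 0
      none = record { sound = λ _ () ; complete = λ () ; mono = λ _ _ () }
      step : ∀ j s → j < n → Inv j s → wp (compareBody ⨾ inc 2) (Inv (suc j)) s
      step j s j<n (kept , i≡ , order , eA , eB) with v , refl ← vertexAt φ j<n =
        (λ less → kept , cong suc i≡ , order ,
          subst (λ i → Enumerates pos _ (arr s sourcePosArr [ reg s lengthReg ↦ i ]) 0 _) (sym i≡)
            (Enumerates-∈ pos-inj (∈I─J less) eA) ,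
          Enumerates-∉ pos-inj (λ v∈ → x∈p─q⇒x∉q J I v∈ (p─q⊆p I J (∈I─J less))) eB) ,
        λ notless →
          (λ greater → kept , cong suc i≡ , order , Enumerates-∉ pos-inj (∉I─J notless) eA ,
            subst (λ i → Enumerates pos _ (arr s targetPosArr [ reg s 3 ↦ i ]) 0 _) (sym i≡)
              (Enumerates-∈ pos-inj (∈J─I greater) eB)) ,
          (λ notgreater → kept , cong suc i≡ , order , Enumerates-∉ pos-inj (∉I─J notless) eA ,
            Enumerates-∉ pos-inj (∉J─I notgreater) eB)
        where
        label : arr s orderArr (reg s 2) ≡ toℕ v
        label = trans (cong (arr s orderArr) i≡) (order v)
        src : arr s sourceArr (arr s orderArr (reg s 2)) ≡ bit (lookup I v)
        src = trans (cong (arr s sourceArr) label) (source′ s kept v)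
        tgt : arr s targetArr (arr s orderArr (reg s 2)) ≡ bit (lookup J v)
        tgt = trans (cong (arr s targetArr) label) (target′ s kept v)
        ∈I─J = λ less → bit-<-true {p = I} {J} v (trans (sym (cong₂ _<ᵇ_ tgt src)) less)
        ∉I─J = λ notless → bit-<-false {p = I} {J} v (trans (sym (cong₂ _<ᵇ_ tgt src)) notless)
        ∈J─I = λ less → bit-<-true {p = J} {I} v (trans (sym (cong₂ _<ᵇ_ src tgt)) less)
        ∉J─I = λ notless → bit-<-false {p = J} {I} v (trans (sym (cong₂ _<ᵇ_ src tgt)) notless)

    Scheduled : State → Set
    Scheduled s = ∃[ A ] ∃[ B ] let d = reg s lengthReg in
      Enumerates pos (_∈ I ─ J) A 0 d × Enumerates pos (_∈ J ─ I) B 0 d ×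
      Schedule φ A B (arr s removedArr) (arr s addedArr) 0 0 d

    module _ (cardIJ : ∣ I ∣ ≡ ∣ J ∣) where

      schedule-correct : ∀ s → Compared s → Runs schedule s Scheduled (2 + loopTime scheduleBody n)
      schedule-correct s₁ (order , eA , eB) = wp-sound (const 3 0 ⨾ copy 4 lengthReg)
          {λ s → tables s ≡ tables s₁ × reg s 3 ≡ 0 × reg s 4 ≡ d} {s₁} (refl , refl , refl)
        andThen λ s (kept , lo≡ , hi≡) → Runs-map conclude (Runs-weaken (Runs-for scheduleBody Inv
          (λ _ s (kept , i≡ , _) → i≡ , cong proj₁ kept) step
          (kept , refl , d , refl , trans (cong (_+ d) lo≡) (sym hi≡) ,
            λ f g _ _ → subst (λ lo → Schedule φ A B f g 0 lo d) lo≡)))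
        where
        d = reg s₁ lengthReg
        A = arr s₁ sourcePosArr
        B = arr s₁ targetPosArr
        -- The loop makes `d` rounds; as `d` is the size of `I ─ J`, its time is bounded in terms of
        -- `n`.
        d≤n : d ≤ n
        d≤n = subst (_≤ n) (sym (Enumerates-card pos-inj d eA)) (∣p∣≤n (I ─ J))
        Runs-weaken : ∀ {p s Q} → Runs p s Q (loopTime scheduleBody d) →
                      Runs p s Q (loopTime scheduleBody n)
        Runs-weaken (s′ , t , run , t≤ , q) =
          s′ , t , run , ≤-trans t≤ (+-monoʳ-≤ 2 (*-monoˡ-≤ (suc (cost scheduleBody + 1)) d≤n)) , q
        tables : State → ℕ × (ℕ → ℕ) × (ℕ → ℕ) × (ℕ → ℕ)
        tables s = reg s lengthReg , arr s orderArr , arr s sourcePosArr , arr s targetPosArr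
        AgreeOutside : ℕ → ℕ → (f f′ : ℕ → ℕ) → Set
        AgreeOutside lo hi f f′ = ∀ c → c < lo ⊎ hi ≤ c → f c ≡ f′ c
        -- The first j moves are in place: any way of filling the free cells with a
        -- schedule of the remaining moves completes the whole schedule.
        Inv : ℕ → State → Set
        Inv j s = tables s ≡ tables s₁ × reg s 2 ≡ j ×
          ∃[ r ] j + r ≡ d × reg s 3 + r ≡ reg s 4 ×
          (∀ f g → AgreeOutside (reg s 3) (reg s 4) f (arr s removedArr) →
                   AgreeOutside (reg s 3) (reg s 4) g (arr s addedArr) →
                   Schedule φ A B f g j (reg s 3) r → Schedule φ A B f g 0 0 d)
        -- Once cell `lo` has been written, any filling of the smaller free interval is also one of
        -- the larger, with that cell settled; `fillʳ` does the same at the upper end, where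
        -- `pred hi` is `lo + r`.
        fillˡ : ∀ {lo r hi f f′ x} → suc (lo + r) ≡ hi → AgreeOutside (suc lo) hi f (f′ [ lo ↦ x ]) →
                AgreeOutside lo hi f f′ × f lo ≡ x
        fillˡ {lo} {r} {hi} {f} {f′} {x} refl agree =
          outer , trans (agree lo (inj₁ ≤-refl)) (update-same f′ lo x)
          where
          outer : AgreeOutside lo hi f f′
          outer c (inj₁ c<lo) = trans (agree c (inj₁ (m<n⇒m<1+n c<lo)))
            (update-other f′ x (<⇒≢ c<lo ∘ sym))
          outer c (inj₂ hi≤c) = trans (agree c (inj₂ hi≤c))
            (update-other f′ x (<⇒≢ (≤-trans (s≤s (m≤m+n lo r)) hi≤c)))
        fillʳ : ∀ {lo r hi f f′ x} → suc (lo + r) ≡ hi →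
                AgreeOutside lo (pred hi) f (f′ [ pred hi ↦ x ]) →
                AgreeOutside lo hi f f′ × f (lo + r) ≡ x
        fillʳ {lo} {r} {hi} {f} {f′} {x} refl agree =
          outer , trans (agree (lo + r) (inj₂ ≤-refl)) (update-same f′ (lo + r) x)
          where
          outer : AgreeOutside lo hi f f′
          outer c (inj₁ c<lo) = trans (agree c (inj₁ c<lo))
            (update-other f′ x (<⇒≢ (<-≤-trans c<lo (m≤m+n lo r)) ∘ sym))
          outer c (inj₂ hi≤c) = trans (agree c (inj₂ (<⇒≤ hi≤c))) (update-other f′ x (<⇒≢ hi≤c))
        step : ∀ j s → j < d → Inv j s → wp (scheduleBody ⨾ inc 2) (Inv (suc j)) s
        step j s j<d (_ , _ , zero , j≡d , _) =
          contradiction (trans (sym (+-identityʳ j)) j≡d) (<⇒≢ j<d)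
        step j s j<d (kept , i≡ , suc r , j+r≡d , lo+r≡hi , complete) =
          (λ right → kept , cong suc i≡ , r , j+1+r≡d , lo+1+r≡hi , λ f g agree-f agree-g rest →
            let outer-f , f≡ = fillˡ lo+1+r≡hi agree-f ; outer-g , g≡ = fillˡ lo+1+r≡hi agree-g in
            complete f g outer-f outer-g (inj₁
              (<ᵇ-true⁻ (trans (sym right≡) right) ,
               labels f≡ sourcePos , labels g≡ targetPos , rest))) ,
          (λ left → kept , cong suc i≡ , r , j+1+r≡d , cong pred lo+1+r≡hi , λ f g agree-f agree-g rest →
            let outer-f , f≡ = fillʳ lo+1+r≡hi agree-f ; outer-g , g≡ = fillʳ lo+1+r≡hi agree-g in
            complete f g outer-f outer-g (inj₂
              (<ᵇ-false⁻ (trans (sym right≡) left) ,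
               labels f≡ sourcePos , labels g≡ targetPos , rest)))
          where
          j+1+r≡d = trans (sym (+-suc j r)) j+r≡d
          lo+1+r≡hi = trans (sym (+-suc (reg s 3) r)) lo+r≡hi
          sourcePos : arr s sourcePosArr (reg s 2) ≡ A j
          sourcePos = cong₂ (λ (_ , _ , a , _) i → a i) kept i≡
          targetPos : arr s targetPosArr (reg s 2) ≡ B j
          targetPos = cong₂ (λ (_ , _ , _ , b) i → b i) kept i≡
          right≡ = cong₂ _<ᵇ_ sourcePos targetPos
          labels : ∀ {l q p} → l ≡ arr s orderArr q → q ≡ p → Labels φ A B l p
          labels l≡ q≡ v v≡ =
            trans l≡ (trans (cong₂ (λ (_ , o , _) i → o i) kept (trans q≡ (sym v≡))) (order v))
        conclude : ∀ s → Inv d s → Scheduled s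
        conclude s (kept , _ , suc r , d≡ , _) = contradiction d≡ (m+1+n≢m d)
        -- No cell is free any more, so the arrays themselves are the filling.
        conclude s (kept , _ , zero , _ , _ , complete) = A , B ,
          subst (Enumerates pos _ A 0) d≡ eA ,
          subst (Enumerates pos _ B 0) (trans (sym (Enumerates-same-size φ cardIJ eA eB)) d≡) eB ,
          subst (Schedule φ A B _ _ 0 0) d≡ (complete _ _ (λ _ _ → refl) (λ _ _ → refl) tt)
          where d≡ = sym (cong proj₁ kept)

-- The whole program and its running time

time : ℕ → ℕ
time n = (1 + loopTime findEndBody n) + ((1 + loopTime walkBody n) +
         ((2 + loopTime compareBody n) + (2 + loopTime scheduleBody n)))

-- The walk is built from the tables and the orientation `ψ` obtained from the run, which may differ
-- from `φ`; this is why its moves are those written to the output.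
program-correct : ∀ {G : Graph n} {I J} → IsPath G → IsPathVertexCover k G I → IsPathVertexCover k G J →
                  ∣ I ∣ ≡ ∣ J ∣ → ComputesShortestTJ k program (time n) G I J
program-correct {k = k} {G = G} {I} {J} φ coverI coverJ cardIJ s₀ enc = Runs-map output
  (findEnd-correct φ s₀ refl andThen λ s (kept , ψ , start) →
   walk-correct ψ s kept start andThen λ s ordered →
   compare-correct ψ s ordered andThen λ s compared →
   Runs-map {R = Done} (λ _ → ψ ,_) (schedule-correct ψ cardIJ s compared))
  where
  open Correctness enc
  Done : State → Set
  Done s = ∃[ ψ ] Scheduled ψ s
  output : ∀ s → Done s →
           ∃[ ℓ ] Σ[ S ∈ TJSequence k G I J ℓ ] IsShortestLength k G I J ℓ × Outputs S s
  output s (ψ , A , B , eA , eB , sched)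
    with w , records ← reconfigure ψ A B (reg s lengthReg) 0 refl coverI coverJ eA eB =
    reg s lengthReg , toSequence w ,
    -- The length register holds the size of `I ─ J`, which is the lower bound.
    subst (IsShortestLength k G I J)
      (sym (Enumerates-card (position-injective ψ) (reg s lengthReg) eA)) ─-shortest ,
    record { lengthOut = refl
           ; removed = λ i → proj₁ (Records-step 0 w (records sched) i)
           ; added = λ i → proj₂ (Records-step 0 w (records sched) i) }

const-∈O : ∀ a → (λ _ → a) ∈O id
-- The threshold 1 is needed because a positive constant exceeds every multiple of 0.
const-∈O a = a , 1 , λ n 1≤n → ≤-trans (≤-reflexive (sym (*-identityʳ a))) (*-monoʳ-≤ a 1≤n)

*-∈O : ∀ a → (λ n → n * a) ∈O id
*-∈O a = a , 0 , λ n _ → ≤-reflexive (*-comm n a)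

+-∈O : ∀ {f g h} → f ∈O h → g ∈O h → (λ n → f n + g n) ∈O h
+-∈O {h = h} (c , m , f≤) (c′ , m′ , g≤) = c + c′ , m + m′ , λ n m+m′≤n →
  ≤-trans (+-mono-≤ (f≤ n (m+n≤o⇒m≤o m m+m′≤n)) (g≤ n (m+n≤o⇒n≤o m m+m′≤n)))
    (≤-reflexive (sym (*-distribʳ-+ (h n) c c′)))

time-∈O : time ∈O id
time-∈O = +-∈O (phase 1 findEndBody) (+-∈O (phase 1 walkBody)
            (+-∈O (phase 2 compareBody) (phase 2 scheduleBody)))
  where
  phase : ∀ a p → (λ n → a + loopTime p n) ∈O id
  phase a p = +-∈O (const-∈O a) (+-∈O (const-∈O 2) (*-∈O (suc (cost p + 1))))

theorem5 : ∀ (k : ℕ) → 2 ≤ k →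
    (∀ {n} (P : Graph n) → IsPath P → (I J : Subset n) →
    IsPathVertexCover k P I → IsPathVertexCover k P J →
    Reconfigurable k P I J ⇔ ∣ I ∣ ≡ ∣ J ∣)
    ×
    (∃[ prog ] ∃[ T ] T ∈O id ×
    (∀ {n} (P : Graph n) → IsPath P → (I J : Subset n) →
    IsPathVertexCover k P I → IsPathVertexCover k P J →
    Reconfigurable k P I J →
    ComputesShortestTJ k prog (T n) P I J))
theorem5 k _ =
  (λ P φ I J coverI coverJ → mk⇔ reconfigurable⇒card (card⇒reconfigurable φ coverI coverJ)) ,
  program , time , time-∈O ,
  λ P φ I J coverI coverJ r → program-correct φ coverI coverJ (reconfigurable⇒card r)
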